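{- Assume the setting in the context, with $\theta=0$ (so $w>0$ and $\delta>0$). Set $A_m=\lfloor z_0/\delta\rfloor$. Write $x_0=\overline{x_0}\,w+\widehat{x_0}$, $l=\overline{l}\,w+\widehat{l}$ with $0\le\widehat{x_0},\widehat{l}<w$; when $y>0$ write $y_0=\overline{y_0}\,y+\widehat{y_0}$, $h=\overline{h}\,y+\widehat{h}$ with $0\le\widehat{y_0},\widehat{h}<y$. (ii.1) If $y=0$, then $$d(m,T)=(1+A_m)(1+A_m+\overline{x_0})+(\overline{l}-2)\frac{A_m(1+A_m)}{2}+\sum_{k=0}^{A_m}\left\lfloor\frac{\widehat{x_0}+k\widehat{l}}{w}\right\rfloor.\quad(**)$$ (ii.2) If $y>0$, set $k_1=\left\lceil\frac{z_0y-y_0\delta}{a}\right\rceil$ (then $k_1\ge0$). (ii.2.1) If $k_1=0$, $d(m,T)$ is given by $(**)$. (ii.2.2) If $1\le k_1\le A_m$, then $$d(m,T)=(1+A_m)(1+A_m+\overline{x_0})+k_1(\overline{y_0}-A_m)+(\overline{l}-2)\frac{A_m(1+A_m)}2+\overline{h}\frac{(k_1-1)k_1}2+\sum_{k=0}^{A_m}\left\lfloor\frac{\widehat{x_0}+k\widehat{l}}{w}\right\rfloor+\sum_{k=0}^{k_1-1}\left\lfloor\frac{\widehat{y_0}+k\widehat{h}}{y}\right\rfloor.$$ (ii.2.3) If $k_1>A_m$, then $$d(m,T)=(1+A_m)(1+\overline{x_0}+\overline{y_0})+(\overline{l}+\overline{h}-2)\frac{A_m(1+A_m)}2+\sum_{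k=0}^{A_m}\left\lfloor\frac{\widehat{x_0}+k\widehat{l}}{w}\right\rfloor+\sum_{k=0}^{A_m}\left\lfloor\frac{\widehat{y_0}+k\widehat{h}}{y}\right\rfloor.$$
   Context: Let $a<b<c$ be positive integers with $\gcd(a,b,c)=1$ and $T=\langle a,b,c\rangle=\{xa+yb+zc:x,y,z\in\mathbb N\}$. For $m\in T$, the denumerant $d(m,T)$ is the number of $(x,y,z)\in\mathbb N^3$ with $xa+yb+zc=m$. For $(i,j)\in\mathbb N^2$ let $[\![i,j]\!]=[i,i+1)\times[j,j+1)\subset\mathbb R^2$. For integers $0\le w<l$, $0\le y<h$, the L-shape $\mathrm L(l,h,w,y)$ is the set of unit squares $[\![i,j]\!]$ with $0\le i<l$, $0\le j<h$, excluding those with $i\ge l-w$ and $j\ge h-y$ (it has $lh-wy$ squares). An L-shape $\mathcal H$ is related to $T$ if it consists of exactly $c$ squares, every residue class modulo $c$ equals $ia+jb \bmod c$ for exactly one $[\![i,j]\!]\in\mathcal H$, and for each $[\![i,j]\!]\in\mathcal H$, $ia+jb=\min\{sa+tb:(s,t)\in\mathbb N^2,\ sa+tb\equiv ia+jb \pmod c\}$. Setting: $\mathcal H=\mathrm L(l,h,w,y)$ is an L-shape related to $T$, and $\delta=(la-yb)/c$, $\theta=(hb-wa)/c$; it is known that $\delta,\theta$ are nonnegative integers with $\delta+\theta>0$, $a=h\delta+y\theta$, $b=w\delta+l\theta$, $lh-wy=c$. For $m\in T$, the basic factorization of $m$ with respect to $\mathcal H$ is the unique $(x_0,y_0,z_0)\in\mathbb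 N^3$ with $x_0a+y_0b+z_0c=m$ and $[\![x_0,y_0]\!]\in\mathcal H$. Fix $m\in T$ with basic factorization $(x_0,y_0,z_0)$. -}

module Defs where

open import Data.Nat
open import Data.Nat.DivMod using (_/_; _%_)
open import Data.Nat.Properties
open import Data.List.Base using (List; length; filter; cartesianProduct; upTo; applyUpTo; sum)
open import Data.List.Membership.Propositional using (_∈_)
open import Data.List.Membership.Propositional.Properties
open import Data.List.Relation.Unary.Unique.Propositional using (Unique)
import Data.List.Relation.Unary.Unique.Propositional.Properties as Unique
open import Data.Product using (_×_; _,_; ∃; ∃!; proj₂)
open import Function using (_⇔_; mk⇔)
open import Relation.Binary.PropositionalEquality using (_≡_; subst)
open import Relation.Nullary using (¬_)
open import Relation.Nullary.Decidable using (_×-dec_; ¬?)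
open import Relation.Unary using (Decidable)

IsFactorization : (a b c m : ℕ) → ℕ × ℕ × ℕ → Set
IsFactorization a b c m (x , y , z) = x * a + y * b + z * c ≡ m

isFactorization? : ∀ a b c m → Decidable (IsFactorization a b c m)
isFactorization? a b c m (x , y , z) = x * a + y * b + z * c ≟ m

_∈⟨_,_,_⟩ : (m a b c : ℕ) → Set
m ∈⟨ a , b , c ⟩ = ∃ (IsFactorization a b c m)

-- The search box [0, m]³ contains every factorization of m, because the
-- generators are positive: see ∈-factorizations.
factorizations : (a b c m : ℕ) → List (ℕ × ℕ × ℕ)
factorizations a b c m = filter (isFactorization? a b c m)
  (cartesianProduct (upTo (suc m)) (cartesianProduct (upTo (suc m)) (upTo (suc m))))

denumerant : (a b c m : ℕ) → ℕ
denumerant a b c m = length (factorizations a b c m)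

factorizations-unique : ∀ a b c m → Unique (factorizations a b c m)
factorizations-unique a b c m = Unique.filter⁺ (isFactorization? a b c m)
  (Unique.cartesianProduct⁺ u (Unique.cartesianProduct⁺ u u))
  where u = Unique.upTo⁺ (suc m)

∈-factorizations : ∀ a b c m .{{_ : NonZero a}} .{{_ : NonZero b}} .{{_ : NonZero c}} →
                   ∀ {t} → t ∈ factorizations a b c m ⇔ IsFactorization a b c m t
∈-factorizations a b c m {x , y , z} = mk⇔
  (λ p → proj₂ (∈-filter⁻ (isFactorization? a b c m) {xs = box} p))
  (λ e → ∈-filter⁺ (isFactorization? a b c m)
    (∈-cartesianProduct⁺ (bound e (≤-trans (m≤m*n x a) (≤-trans xa≤xa+yb xa+yb≤)))
      (∈-cartesianProduct⁺
        (bound e (≤-trans (m≤m*n y b) (≤-trans (m≤n+m (y * b) (x * a)) xa+yb≤)))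
        (bound e (≤-trans (m≤m*n z c) (m≤n+m (z * c) (x * a + y * b))))))
    e)
  where
  box = cartesianProduct (upTo (suc m)) (cartesianProduct (upTo (suc m)) (upTo (suc m)))
  xa≤xa+yb : x * a ≤ x * a + y * b
  xa≤xa+yb = m≤m+n (x * a) (y * b)
  xa+yb≤ : x * a + y * b ≤ x * a + y * b + z * c
  xa+yb≤ = m≤m+n (x * a + y * b) (z * c)
  bound : ∀ {u v} → v ≡ m → u ≤ v → u ∈ upTo (suc m)
  bound e u≤v = ∈-upTo⁺ (s≤s (subst (_ ≤_) e u≤v))

record LShape : Set where
  field
    l h w y : ℕ
    w<l     : w < l
    y<h     : y < h

-- The unit square [i, i+1) × [j, j+1) is represented by its corner (i , j).
module _ (H : LShape) where
  open LShape H

  IsSquare : ℕ × ℕ → Set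
  IsSquare (i , j) = i < l × j < h × ¬ (i ≥ l ∸ w × j ≥ h ∸ y)

  isSquare? : Decidable IsSquare
  isSquare? (i , j) = i <? l ×-dec (j <? h ×-dec ¬? (i ≥? l ∸ w ×-dec j ≥? h ∸ y))

  squares : List (ℕ × ℕ)
  squares = filter isSquare? (cartesianProduct (upTo l) (upTo h))

-- minimal: the minimum over a residue class is attained at (i , j) itself, so
-- only the lower bound has to be required.
record Related (H : LShape) (a b c : ℕ) .{{_ : NonZero c}} : Set where
  field
    size    : length (squares H) ≡ c
    residue : ∀ r → r < c →
              ∃! _≡_ λ ((i , j) : ℕ × ℕ) → IsSquare H (i , j) × (i * a + j * b) % c ≡ r
    minimal : ∀ i j → IsSquare H (i , j) →
              ∀ s t → (s * a + t * b) % c ≡ (i * a + j * b) % c →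
              i * a + j * b ≤ s * a + t * b

IsBasicFactorization : (H : LShape) (a b c m : ℕ) → ℕ × ℕ × ℕ → Set
IsBasicFactorization H a b c m (x₀ , y₀ , z₀) =
  IsFactorization a b c m (x₀ , y₀ , z₀) × IsSquare H (x₀ , y₀)

-- The upper limit is exclusive: ∑ over 0 ≤ k < n.
floorSum : (n u v d : ℕ) .{{_ : NonZero d}} → ℕ
floorSum n u v d = sum (applyUpTo (λ k → (u + k * v) / d) n)

{-# OPTIONS --safe #-}

-- Every factorization of m arises from the basic one (x₀ , y₀ , z₀) as
-- (x₀ + k l - n w , y₀ - k y + n h , z₀ - k δ) for unique k , n ≥ 0: a point outside the
-- L-shape can be moved by (- l , y), (w , - h) or their sum, staying in the first quadrant
-- and lowering a positive linear form, until it lies in the L-shape. Hence the denumerant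
-- counts the pairs (k , n) with k ≤ A = ⌊z₀ / δ⌋, n w ≤ x₀ + k l and k y ≤ y₀ + n h. Without
-- the last condition there are Σ (1 + ⌊(x₀ + k l) / w⌋) of them, and the pairs violating it
-- satisfy ⌊(y₀ + n h) / y⌋ < k ≤ A, with n < k₁ because a = h δ.
module Submission where

open import Defs
open import Data.List.Base using (List; []; _∷_; [_]; _++_; length; map; filter; cartesianProduct; upTo; applyUpTo)
open import Data.List.Properties using (length-map; length-++; length-upTo; applyUpTo-∷ʳ)
open import Data.List.Membership.Propositional using (_∈_)
open import Data.List.Membership.Propositional.Properties
open import Data.List.Membership.Propositional.Properties.WithK using (unique∧set⇒bag)
open import Data.List.Relation.Binary.BagAndSetEquality using (∼bag⇒↭)
open import Data.List.Relation.Binary.Permutation.Propositional.Properties using (↭-length)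
import Data.List.Relation.Unary.All as All
open import Data.List.Relation.Unary.Any using (here; there)
open import Data.List.Relation.Unary.AllPairs using ([]; _∷_)
open import Data.List.Relation.Unary.Unique.Propositional using (Unique)
import Data.List.Relation.Unary.Unique.Propositional.Properties as Unique
open import Data.Product using (_×_; _,_; ∃-syntax; proj₁; proj₂)
open import Data.Sum using (inj₁; inj₂)
open import Function using (mk⇔; Equivalence; id)
open import Relation.Binary.PropositionalEquality hiding ([_])
open import Relation.Nullary using (¬_; Dec; yes; no)
open import Relation.Nullary.Decidable using (¬?)
open import Relation.Unary using (Decidable)

-- Counting by bijections, lattice points under a graph, and the area of an L-shape.

module Counting where

  open import Data.Nat
  open import Data.Nat.Properties
  open import Data.Nat.ListAction using (sum)
  open import Data.Nat.ListAction.Properties using (sum-++)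

  -- Injectivity is asked only on members of the list: maps built from truncated subtraction, such
  -- as `shifted`, are treated where that subtraction is exact.
  map-unique : ∀ {A B : Set} (f : A → B) {xs} →
               (∀ {u v} → u ∈ xs → v ∈ xs → f u ≡ f v → u ≡ v) →
               Unique xs → Unique (map f xs)
  map-unique f inj [] = []
  map-unique f {x ∷ xs} inj (x∉ ∷ u) =
    All.tabulate (λ p e → let _ , q , e′ = ∈-map⁻ f p in
      All.lookup x∉ q (inj (here refl) (there q) (trans e e′)))
    ∷ map-unique f (λ p q → inj (there p) (there q)) u

  -- Two duplicate-free lists with the same members are permutations of each other, so `map f xs`
  -- and `ys` need only be compared as sets.
  length-bijection : ∀ {A B : Set} (f : A → B) {xs ys} → Unique xs → Unique ys →
                     (∀ {u} → u ∈ xs → f u ∈ ys) →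
                     (∀ {u v} → u ∈ xs → v ∈ xs → f u ≡ f v → u ≡ v) →
                     (∀ {v} → v ∈ ys → ∃[ u ] u ∈ xs × v ≡ f u) →
                     length xs ≡ length ys
  length-bijection f {xs} {ys} ux uy into inj onto = trans (sym (length-map f xs))
    (↭-length (∼bag⇒↭ (unique∧set⇒bag (map-unique f inj ux) uy
      (mk⇔ (λ p → let _ , q , e = ∈-map⁻ f p in subst (_∈ ys) (sym e) (into q))
           (λ p → let _ , q , e = onto p in subst (_∈ map f xs) (sym e) (∈-map⁺ f q))))))

  length-filter+ : ∀ {A : Set} {P : A → Set} (P? : Decidable P) xs →
                   length (filter P? xs) + length (filter (λ x → ¬? (P? x)) xs) ≡ length xs
  length-filter+ P? [] = refl
  length-filter+ P? (x ∷ xs) with P? x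
  ... | yes _ = cong suc (length-filter+ P? xs)
  ... | no _ = trans (+-suc _ _) (cong suc (length-filter+ P? xs))

  -- Counting by exclusion: `f` matches `ys` with the members of `xs` that fail `P`. It serves for
  -- the notch of an L-shape and for the pairs whose shift has a negative second coordinate.
  length-complement : ∀ {A B : Set} {P : A → Set} (P? : Decidable P) (f : B → A) {xs ys} →
                      Unique xs → Unique ys →
                      (∀ {u} → u ∈ ys → f u ∈ xs × ¬ P (f u)) →
                      (∀ {u v} → u ∈ ys → v ∈ ys → f u ≡ f v → u ≡ v) →
                      (∀ {v} → v ∈ xs → ¬ P v → ∃[ u ] u ∈ ys × v ≡ f u) →
                      length (filter P? xs) + length ys ≡ length xs
  length-complement P? f {xs} ux uy into inj onto = trans
    (cong (length (filter P? xs) +_) (length-bijection f uy (Unique.filter⁺ ¬P? ux)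
      (λ p → let q , np = into p in ∈-filter⁺ ¬P? q np) inj
      (λ p → let q , np = ∈-filter⁻ ¬P? {xs = xs} p in onto q np)))
    (length-filter+ P? xs)
    where ¬P? = λ x → ¬? (P? x)

  ∑ : ℕ → (ℕ → ℕ) → ℕ
  ∑ zero    f = 0
  ∑ (suc n) f = ∑ n f + f n

  sum-applyUpTo : ∀ f n → sum (applyUpTo f n) ≡ ∑ n f
  sum-applyUpTo f zero    = refl
  sum-applyUpTo f (suc n) = begin
    sum (applyUpTo f (suc n))        ≡⟨ cong sum (applyUpTo-∷ʳ f n) ⟨
    sum (applyUpTo f n ++ [ f n ])   ≡⟨ sum-++ (applyUpTo f n) [ f n ] ⟩
    sum (applyUpTo f n) + (f n + 0)  ≡⟨ cong₂ _+_ (sum-applyUpTo f n) (+-identityʳ (f n)) ⟩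
    ∑ n f + f n                      ∎
    where open ≡-Reasoning

  region : ℕ → (ℕ → ℕ) → List (ℕ × ℕ)
  region zero    f = []
  region (suc n) f = region n f ++ map (n ,_) (upTo (f n))

  ∈-region⁻ : ∀ n f {i j} → (i , j) ∈ region n f → i < n × j < f i
  ∈-region⁻ (suc n) f p with ∈-++⁻ (region n f) p
  ... | inj₁ q = let i<n , j<f = ∈-region⁻ n f q in m<n⇒m<1+n i<n , j<f
  ... | inj₂ q with _ , r , refl ← ∈-map⁻ (n ,_) q = ≤-refl , ∈-upTo⁻ r

  ∈-region⁺ : ∀ n f {i j} → i < n → j < f i → (i , j) ∈ region n f
  ∈-region⁺ (suc n) f {i} i<1+n j<f with i ≟ n
  ... | yes refl = ∈-++⁺ʳ (region n f) (∈-map⁺ (n ,_) (∈-upTo⁺ j<f))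
  ... | no i≢n   = ∈-++⁺ˡ (∈-region⁺ n f (≤∧≢⇒< (s≤s⁻¹ i<1+n) i≢n) j<f)

  region-unique : ∀ n f → Unique (region n f)
  region-unique zero    f = []
  region-unique (suc n) f = Unique.++⁺ (region-unique n f)
    (Unique.map⁺ (cong proj₂) (Unique.upTo⁺ (f n)))
    λ (p , q) → let _ , _ , e = ∈-map⁻ (n ,_) q in
      <⇒≢ (proj₁ (∈-region⁻ n f p)) (cong proj₁ e)

  length-region : ∀ n f → length (region n f) ≡ ∑ n f
  length-region zero    f = refl
  length-region (suc n) f = trans (length-++ (region n f))
    (cong₂ _+_ (length-region n f) (trans (length-map (n ,_) (upTo (f n))) (length-upTo (f n))))

  length-cartesianProduct : ∀ {A B : Set} (xs : List A) (ys : List B) →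
                            length (cartesianProduct xs ys) ≡ length xs * length ys
  length-cartesianProduct []       ys = refl
  length-cartesianProduct (x ∷ xs) ys = trans (length-++ (map (x ,_) ys))
    (cong₂ _+_ (length-map (x ,_) ys) (length-cartesianProduct xs ys))

  module _ (H : LShape) where
    open LShape H

    -- The squares cut out of the l × h rectangle form a w × y rectangle translated by (l - w , h -
    -- y).
    length-squares : length (squares H) + w * y ≡ l * h
    length-squares = begin
      length (squares H) + w * y
        ≡⟨ cong (length (squares H) +_) (length-upTo² w y) ⟨
      length (squares H) + length (cartesianProduct (upTo w) (upTo y))
        ≡⟨ length-complement (isSquare? H) (λ (i , j) → l ∸ w + i , h ∸ y + j)
             (cart l h) (cart w y) into inj onto ⟩
      length (cartesianProduct (upTo l) (upTo h))
        ≡⟨ length-upTo² l h ⟩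
      l * h ∎
      where
      open ≡-Reasoning
      length-upTo² : ∀ m n → length (cartesianProduct (upTo m) (upTo n)) ≡ m * n
      length-upTo² m n = trans (length-cartesianProduct (upTo m) (upTo n))
                               (cong₂ _*_ (length-upTo m) (length-upTo n))
      cart : ∀ m n → Unique (cartesianProduct (upTo m) (upTo n))
      cart m n = Unique.cartesianProduct⁺ (Unique.upTo⁺ m) (Unique.upTo⁺ n)
      shift< : ∀ {i p q} → p < q → i < p → q ∸ p + i < q
      shift< {i} {p} {q} p<q i<p = <-≤-trans (+-monoʳ-< (q ∸ p) i<p) (≤-reflexive (m∸n+n≡m (<⇒≤ p<q)))
      into : ∀ {u} → u ∈ cartesianProduct (upTo w) (upTo y) →
             (l ∸ w + proj₁ u , h ∸ y + proj₂ u) ∈ cartesianProduct (upTo l) (upTo h) ×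
             ¬ IsSquare H (l ∸ w + proj₁ u , h ∸ y + proj₂ u)
      into p = let i∈ , j∈ = ∈-cartesianProduct⁻ (upTo w) (upTo y) p in
        ∈-cartesianProduct⁺ (∈-upTo⁺ (shift< w<l (∈-upTo⁻ i∈))) (∈-upTo⁺ (shift< y<h (∈-upTo⁻ j∈))) ,
        λ (_ , _ , ¬q) → ¬q (m≤m+n _ _ , m≤m+n _ _)
      inj : ∀ {u v} → _ → _ → (l ∸ w + proj₁ u , h ∸ y + proj₂ u) ≡ (l ∸ w + proj₁ v , h ∸ y + proj₂ v) → u ≡ v
      inj _ _ e = cong₂ _,_ (+-cancelˡ-≡ (l ∸ w) _ _ (cong proj₁ e)) (+-cancelˡ-≡ (h ∸ y) _ _ (cong proj₂ e))
      unshift : ∀ {i p q} → p < q → i < q → q ∸ p ≤ i → i ∸ (q ∸ p) < p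
      unshift {i} {p} {q} p<q i<q q∸p≤i = <-≤-trans (∸-monoˡ-< i<q q∸p≤i) (≤-reflexive (m∸[m∸n]≡n (<⇒≤ p<q)))
      onto : ∀ {v} → v ∈ cartesianProduct (upTo l) (upTo h) → ¬ IsSquare H v →
             ∃[ u ] u ∈ cartesianProduct (upTo w) (upTo y) × v ≡ (l ∸ w + proj₁ u , h ∸ y + proj₂ u)
      onto {i , j} p ¬sq with i∈ , j∈ ← ∈-cartesianProduct⁻ (upTo l) (upTo h) p
        with l ∸ w ≤? i | h ∸ y ≤? j
      ... | yes i≥ | yes j≥ = (i ∸ (l ∸ w) , j ∸ (h ∸ y)) ,
        ∈-cartesianProduct⁺ (∈-upTo⁺ (unshift w<l (∈-upTo⁻ i∈) i≥)) (∈-upTo⁺ (unshift y<h (∈-upTo⁻ j∈) j≥)) ,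
        sym (cong₂ _,_ (m+[n∸m]≡n i≥) (m+[n∸m]≡n j≥))
      ... | no i≱ | _ with () ← ¬sq (∈-upTo⁻ i∈ , ∈-upTo⁻ j∈ , λ (q , _) → i≱ q)
      ... | _ | no j≱ with () ← ¬sq (∈-upTo⁻ i∈ , ∈-upTo⁻ j∈ , λ (_ , q) → j≱ q)

-- The lattice generated by (l , - y) and (- w , h), and reduction into the L-shape.

module Lattice where

  open import Data.Nat
  open import Data.Nat.Properties
  open import Data.Nat.DivMod
  open import Data.Nat.Induction using (Acc; acc; <-wellFounded)
  open import Data.Nat.Tactic.RingSolver using (solve)
  open Counting

  module Relations (l h w y a b c δ : ℕ) .{{_ : NonZero a}} .{{_ : NonZero b}} .{{_ : NonZero c}}
                   (y<h : y < h) (c+wy≡lh : c + w * y ≡ l * h)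
                   (la≡yb+δc : l * a ≡ y * b + δ * c) (hb≡wa : h * b ≡ w * a) where

    instance
      h≢0 : NonZero h
      h≢0 = >-nonZero (m<n⇒0<n y<h)

      w≢0 : NonZero w
      w≢0 = m*n≢0⇒m≢0 w {a} {{subst NonZero hb≡wa (m*n≢0 h b)}}

    -- Multiplying l a = y b + δ c by h and replacing h b by w a gives l h a = h δ c + w y a, while
    -- l h = c + w y. Cancel w y a, then c.
    a≡hδ : a ≡ h * δ
    a≡hδ = sym (*-cancelʳ-≡ (h * δ) a c (+-cancelʳ-≡ (w * y * a) _ _ (begin
      h * δ * c + w * y * a     ≡⟨ solve (h ∷ δ ∷ c ∷ w ∷ y ∷ a ∷ []) ⟩
      h * (δ * c) + y * (w * a) ≡⟨ cong (λ t → h * (δ * c) + y * t) hb≡wa ⟨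
      h * (δ * c) + y * (h * b) ≡⟨ solve (h ∷ δ ∷ c ∷ b ∷ y ∷ []) ⟩
      h * (y * b + δ * c)       ≡⟨ cong (h *_) la≡yb+δc ⟨
      h * (l * a)               ≡⟨ solve (h ∷ l ∷ a ∷ []) ⟩
      a * (l * h)               ≡⟨ cong (a *_) c+wy≡lh ⟨
      a * (c + w * y)           ≡⟨ solve (a ∷ c ∷ w ∷ y ∷ []) ⟩
      a * c + w * y * a         ∎)))
      where open ≡-Reasoning

    instance
      δ≢0 : NonZero δ
      δ≢0 = m*n≢0⇒n≢0 h {{subst NonZero a≡hδ (>-nonZero (n≢0⇒n>0 (≢-nonZero⁻¹ a)))}}

    -- (i , j) = (i′ , j′) + k (l , - y) + n (- w , h), without subtraction.
    record Shift (k n : ℕ) (p q : ℕ × ℕ) : Set where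
      constructor shift
      field
        eq₁ : proj₁ p + n * w ≡ proj₁ q + k * l
        eq₂ : proj₂ p + k * y ≡ proj₂ q + n * h

    shift-trans : ∀ {k n k′ n′ p q r} → Shift k n p q → Shift k′ n′ q r → Shift (k + k′) (n + n′) p r
    shift-trans {k} {n} {k′} {n′} {i , j} {i′ , j′} {i″ , j″} (shift e₁ e₂) (shift e₃ e₄) =
      -- The second coordinate obeys the law of the first, with k and n exchanged and y , h in place
      -- of w , l.
      shift (add n n′ k k′ w l e₁ e₃) (add k k′ n n′ y h e₂ e₄)
      where
      open ≡-Reasoning
      add : ∀ {i i′ i″} n n′ k k′ w l → i + n * w ≡ i′ + k * l → i′ + n′ * w ≡ i″ + k′ * l →
            i + (n + n′) * w ≡ i″ + (k + k′) * l
      add {i} {i′} {i″} n n′ k k′ w l e e′ = begin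
        i + (n + n′) * w         ≡⟨ solve (i ∷ n ∷ n′ ∷ w ∷ []) ⟩
        (i + n * w) + n′ * w     ≡⟨ cong (_+ n′ * w) e ⟩
        (i′ + k * l) + n′ * w    ≡⟨ solve (i′ ∷ k ∷ l ∷ n′ ∷ w ∷ []) ⟩
        (i′ + n′ * w) + k * l    ≡⟨ cong (_+ k * l) e′ ⟩
        (i″ + k′ * l) + k * l    ≡⟨ solve (i″ ∷ k ∷ l ∷ k′ ∷ []) ⟩
        i″ + (k + k′) * l        ∎

    -- The form i a + j b takes the value l a - y b = δ c on (l , - y) and h b - w a = 0 on (- w ,
    -- h). This is where θ = 0 enters: n leaves no trace.
    shift-value : ∀ {k n i j i′ j′} → Shift k n (i , j) (i′ , j′) →
                  i * a + j * b ≡ i′ * a + j′ * b + k * δ * c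
    shift-value {k} {n} {i} {j} {i′} {j′} (shift e₁ e₂) = +-cancelʳ-≡ (n * (w * a) + k * (y * b)) _ _ (begin
      i * a + j * b + (n * (w * a) + k * (y * b))
        ≡⟨ solve (i ∷ a ∷ j ∷ b ∷ n ∷ w ∷ k ∷ y ∷ []) ⟩
      (i + n * w) * a + (j + k * y) * b
        ≡⟨ cong₂ (λ s t → s * a + t * b) e₁ e₂ ⟩
      (i′ + k * l) * a + (j′ + n * h) * b
        ≡⟨ solve (i′ ∷ k ∷ l ∷ a ∷ j′ ∷ n ∷ h ∷ b ∷ []) ⟩
      i′ * a + j′ * b + k * (l * a) + n * (h * b)
        ≡⟨ cong₂ (λ s t → i′ * a + j′ * b + k * s + n * t) la≡yb+δc hb≡wa ⟩
      i′ * a + j′ * b + k * (y * b + δ * c) + n * (w * a)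
        ≡⟨ solve (i′ ∷ k ∷ a ∷ j′ ∷ n ∷ w ∷ b ∷ c ∷ y ∷ δ ∷ []) ⟩
      i′ * a + j′ * b + k * δ * c + (n * (w * a) + k * (y * b)) ∎)
      where open ≡-Reasoning

    -- A linear form taking the value l h - w y = c on both (l , - y) and (- w , h).
    height : ℕ × ℕ → ℕ
    height (i , j) = (h + y) * i + (l + w) * j

    -- This measures the progress of the reduction: every nontrivial shift costs at least c. The
    -- form i a + j b could not serve, being constant along (- w , h).
    shift-height : ∀ {k n p q} → Shift k n p q → height p ≡ height q + (k + n) * c
    shift-height {k} {n} {i , j} {i′ , j′} (shift e₁ e₂) =
      +-cancelʳ-≡ ((h + y) * (n * w) + (l + w) * (k * y)) _ _ (begin
      (h + y) * i + (l + w) * j + ((h + y) * (n * w) + (l + w) * (k * y))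
        ≡⟨ solve (h ∷ y ∷ i ∷ l ∷ w ∷ j ∷ n ∷ k ∷ []) ⟩
      (h + y) * (i + n * w) + (l + w) * (j + k * y)
        ≡⟨ cong₂ (λ s t → (h + y) * s + (l + w) * t) e₁ e₂ ⟩
      (h + y) * (i′ + k * l) + (l + w) * (j′ + n * h)
        ≡⟨ solve (h ∷ y ∷ i′ ∷ l ∷ w ∷ j′ ∷ n ∷ k ∷ []) ⟩
      (h + y) * i′ + (l + w) * j′ + (k + n) * (l * h) + (k * (y * l) + n * (h * w))
        ≡⟨ cong (λ t → (h + y) * i′ + (l + w) * j′ + (k + n) * t + (k * (y * l) + n * (h * w))) c+wy≡lh ⟨
      (h + y) * i′ + (l + w) * j′ + (k + n) * (c + w * y) + (k * (y * l) + n * (h * w))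
        ≡⟨ solve (h ∷ y ∷ i′ ∷ l ∷ w ∷ j′ ∷ n ∷ k ∷ c ∷ []) ⟩
      (h + y) * i′ + (l + w) * j′ + (k + n) * c + ((h + y) * (n * w) + (l + w) * (k * y)) ∎)
      where open ≡-Reasoning

  module Reduction (H : LShape) (a b c δ : ℕ) .{{_ : NonZero a}} .{{_ : NonZero b}} .{{_ : NonZero c}}
                   (rel : Related H a b c)
                   (la≡yb+δc : LShape.l H * a ≡ LShape.y H * b + δ * c)
                   (hb≡wa : LShape.h H * b ≡ LShape.w H * a) where

    open LShape H
    open Related rel

    abstract
      c+wy≡lh : c + w * y ≡ l * h
      c+wy≡lh = subst (λ s → s + w * y ≡ l * h) size (length-squares H)

    open Relations l h w y a b c δ y<h c+wy≡lh la≡yb+δc hb≡wa public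

    up : ∀ i u → i + 1 * u ≡ i + u + 0
    up i u = trans (cong (i +_) (+-identityʳ u)) (sym (+-identityʳ (i + u)))

    down : ∀ {i u} → u ≤ i → i + 0 ≡ i ∸ u + 1 * u
    down {i} {u} u≤i = begin
      i + 0         ≡⟨ +-identityʳ i ⟩
      i             ≡⟨ m∸n+n≡m u≤i ⟨
      i ∸ u + u     ≡⟨ cong (i ∸ u +_) (+-identityʳ u) ⟨
      i ∸ u + 1 * u ∎
      where open ≡-Reasoning

    -- One coordinate of the diagonal move (l , - y) + (- w , h) = (l - w , h - y).
    corner : ∀ {u v i} → u < v → v ∸ u ≤ i → i + 1 * u ≡ i ∸ (v ∸ u) + 1 * v
    corner {u} {v} {i} u<v v-u≤i = begin
      i + 1 * u                  ≡⟨ cong₂ _+_ (m∸n+n≡m v-u≤i) (sym (*-identityˡ u)) ⟨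
      i ∸ (v ∸ u) + (v ∸ u) + u  ≡⟨ +-assoc (i ∸ (v ∸ u)) (v ∸ u) u ⟩
      i ∸ (v ∸ u) + (v ∸ u + u)  ≡⟨ cong (i ∸ (v ∸ u) +_) (m∸n+n≡m (<⇒≤ u<v)) ⟩
      i ∸ (v ∸ u) + v            ≡⟨ cong (i ∸ (v ∸ u) +_) (*-identityˡ v) ⟨
      i ∸ (v ∸ u) + 1 * v        ∎
      where open ≡-Reasoning

    outside⇒shift : ∀ p → ¬ IsSquare H p → ∃[ k ] ∃[ n ] ∃[ q ] 0 < k + n × Shift k n p q
    outside⇒shift (i , j) ¬sq = go (l ≤? i) (h ≤? j)
      where
      go : Dec (l ≤ i) → Dec (h ≤ j) → ∃[ k ] ∃[ n ] ∃[ q ] 0 < k + n × Shift k n (i , j) q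
      go (yes l≤i) _         = 1 , 0 , (i ∸ l , j + y) , s≤s z≤n , shift (down l≤i) (up j y)
      go (no _)    (yes h≤j) = 0 , 1 , (i + w , j ∸ h) , s≤s z≤n , shift (up i w) (down h≤j)
      -- A point of the l × h rectangle outside the L-shape lies in the notch, so both coordinates
      -- admit the diagonal move.
      go (no l≰i)  (no h≰j)  = 1 , 1 , (i ∸ (l ∸ w) , j ∸ (h ∸ y)) , s≤s z≤n ,
        shift (corner w<l (≮⇒≥ λ i< → ¬sq (≰⇒> l≰i , ≰⇒> h≰j , λ (i≥ , _) → <⇒≱ i< i≥)))
              (corner y<h (≮⇒≥ λ j< → ¬sq (≰⇒> l≰i , ≰⇒> h≰j , λ (_ , j≥) → <⇒≱ j< j≥)))

    Reducible : ℕ × ℕ → Set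
    Reducible p = ∃[ k ] ∃[ n ] ∃[ q ] IsSquare H q × Shift k n p q

    reduce : ∀ p → Acc _<_ (height p) → Reducible p
    reduce p (acc rs) = go (isSquare? H p)
      where
      go : Dec (IsSquare H p) → Reducible p
      go (yes sq) = 0 , 0 , p , sq , shift refl refl
      go (no ¬sq) =
        let k , n , q , 0<k+n , sh = outside⇒shift p ¬sq
            q<p = subst (height q <_) (sym (shift-height sh))
                    (m<m+n (height q) (>-nonZero⁻¹ _ {{m*n≢0 (k + n) c {{>-nonZero 0<k+n}}}}))
            k′ , n′ , r , sq , sh′ = reduce q (rs q<p)
        in k + k′ , n + n′ , r , sq , shift-trans sh sh′

    -- Each removed copy of (l , - y) lowers the value by δ c, which raising z by δ restores.
    shift-value′ : ∀ {k n i j i′ j′} z → Shift k n (i , j) (i′ , j′) →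
                   i * a + j * b + z * c ≡ i′ * a + j′ * b + (z + k * δ) * c
    shift-value′ {k} {n} {i} {j} {i′} {j′} z sh = begin
      i * a + j * b + z * c                  ≡⟨ cong (_+ z * c) (shift-value sh) ⟩
      i′ * a + j′ * b + k * δ * c + z * c    ≡⟨ +-assoc (i′ * a + j′ * b) _ _ ⟩
      i′ * a + j′ * b + (k * δ * c + z * c)  ≡⟨ cong (i′ * a + j′ * b +_) (*-distribʳ-+ c (k * δ) z) ⟨
      i′ * a + j′ * b + (k * δ + z) * c      ≡⟨ cong (λ t → i′ * a + j′ * b + t * c) (+-comm (k * δ) z) ⟩
      i′ * a + j′ * b + (z + k * δ) * c      ∎
      where open ≡-Reasoning

    factorization-% : ∀ {m i j z} → IsFactorization a b c m (i , j , z) → m % c ≡ (i * a + j * b) % c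
    factorization-% {_} {i} {j} {z} e =
      trans (cong (_% c) (sym e)) ([m+kn]%n≡m%n (i * a + j * b) z c)

    -- Modulo c the term z c vanishes, so both squares represent the residue class of m and
    -- coincide; then z is determined as well.
    basic-unique : ∀ {m i j z i′ j′ z′} → IsBasicFactorization H a b c m (i , j , z) →
                   IsBasicFactorization H a b c m (i′ , j′ , z′) → (i , j , z) ≡ (i′ , j′ , z′)
    basic-unique {m} {i} {j} {z} {i′} {j′} {z′} (e , sq) (e′ , sq′)
      with _ , _ , unique ← residue ((i * a + j * b) % c) (m%n<n (i * a + j * b) c)
      with refl ← unique (sq , refl)
      with refl ← unique (sq′ , trans (sym (factorization-% {i = i′} {j′} {z′} e′)) (factorization-% {i = i} {j} {z} e))
      = cong (λ t → i , j , t) (*-cancelʳ-≡ z z′ c (+-cancelˡ-≡ (i * a + j * b) _ _ (trans e (sym e′))))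

    module _ {m i₀ j₀ z₀} (basic : IsBasicFactorization H a b c m (i₀ , j₀ , z₀)) where

      -- Reducing (i , j) into the L-shape while raising z accordingly ends at a basic factorization
      -- of m, which by uniqueness is the given one.
      factorization⇒shift : ∀ {i j z} → IsFactorization a b c m (i , j , z) →
                            ∃[ k ] ∃[ n ] Shift k n (i , j) (i₀ , j₀) × z + k * δ ≡ z₀
      factorization⇒shift {i} {j} {z} e =
        let k , n , _ , sq , sh = reduce (i , j) (<-wellFounded _)
            reduced≡basic = basic-unique {z = z + k * δ} {z′ = z₀} (trans (sym (shift-value′ z sh)) e , sq) basic
        in k , n , subst (λ (i′ , j′ , _) → Shift k n (i , j) (i′ , j′)) reduced≡basic sh ,
           cong (λ (_ , _ , z′) → z′) reduced≡basic

      shift⇒factorization : ∀ {k n i j z} → Shift k n (i , j) (i₀ , j₀) → z + k * δ ≡ z₀ →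
                            IsFactorization a b c m (i , j , z)
      shift⇒factorization {z = z} sh refl = trans (shift-value′ z sh) (proj₁ basic)

-- Factorizations as pairs (k , n), and the pairs to be excluded.

module Shifts where
  open import Data.Nat
  open import Data.Nat.Properties
  open import Data.Nat.DivMod
  open Counting
  open Lattice

  m*n≤o⇒m≤o/n : ∀ {m n o} .{{_ : NonZero n}} → m * n ≤ o → m ≤ o / n
  m*n≤o⇒m≤o/n {m} {n} {o} mn≤o = subst (_≤ o / n) (m*n/n≡m m n) (/-monoˡ-≤ n mn≤o)

  m≤o/n⇒m*n≤o : ∀ {m n o} .{{_ : NonZero n}} → m ≤ o / n → m * n ≤ o
  m≤o/n⇒m*n≤o {m} {n} {o} m≤ = ≤-trans (*-monoˡ-≤ n m≤) (m/n*n≤m o n)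

  module Denumerant (H : LShape) (a b c δ : ℕ) .{{_ : NonZero a}} .{{_ : NonZero b}} .{{_ : NonZero c}}
                    (rel : Related H a b c)
                    (la≡yb+δc : LShape.l H * a ≡ LShape.y H * b + δ * c)
                    (hb≡wa : LShape.h H * b ≡ LShape.w H * a)
                    (m x₀ y₀ z₀ : ℕ) (basic : IsBasicFactorization H a b c m (x₀ , y₀ , z₀)) where

    open LShape H
    open Reduction H a b c δ rel la≡yb+δc hb≡wa public

    A : ℕ
    A = z₀ / δ

    -- The pairs (k , n) whose shift of the basic factorization has x ≥ 0 and z ≥ 0.
    candidates : List (ℕ × ℕ)
    candidates = region (suc A) (λ k → suc ((x₀ + k * l) / w))

    -- Nonnegativity of the second coordinate, kept out of `candidates` so that the candidates are
    -- counted by a plain sum over k.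
    Valid : ℕ × ℕ → Set
    Valid (k , n) = k * y ≤ y₀ + n * h

    valid? : Decidable Valid
    valid? (k , n) = k * y ≤? y₀ + n * h

    -- All three truncated subtractions are exact on the valid candidates.
    shifted : ℕ × ℕ → ℕ × ℕ × ℕ
    shifted (k , n) = x₀ + k * l ∸ n * w , y₀ + n * h ∸ k * y , z₀ ∸ k * δ

    ∈-candidates⁻ : ∀ {k n} → (k , n) ∈ candidates → k * δ ≤ z₀ × n * w ≤ x₀ + k * l
    ∈-candidates⁻ p = let k< , n< = ∈-region⁻ (suc A) _ p in
      m≤o/n⇒m*n≤o (s≤s⁻¹ k<) , m≤o/n⇒m*n≤o (s≤s⁻¹ n<)

    ∈-candidates⁺ : ∀ {k n} → k * δ ≤ z₀ → n * w ≤ x₀ + k * l → (k , n) ∈ candidates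
    ∈-candidates⁺ p q = ∈-region⁺ (suc A) _ (s≤s (m*n≤o⇒m≤o/n p)) (s≤s (m*n≤o⇒m≤o/n q))

    candidates-unique = region-unique (suc A) (λ k → suc ((x₀ + k * l) / w))

    length-valid : length (filter valid? candidates) ≡ denumerant a b c m
    length-valid = length-bijection shifted (Unique.filter⁺ valid? candidates-unique)
      (factorizations-unique a b c m) into inj onto
      where
      ∈-valid⁻ : ∀ {k n} → (k , n) ∈ filter valid? candidates →
                 (k * δ ≤ z₀ × n * w ≤ x₀ + k * l) × Valid (k , n)
      ∈-valid⁻ p = let q , y≥0 = ∈-filter⁻ valid? {xs = candidates} p in ∈-candidates⁻ q , y≥0
      into : ∀ {p} → p ∈ filter valid? candidates → shifted p ∈ factorizations a b c m
      into {k , n} p = let (z≥0 , x≥0) , y≥0 = ∈-valid⁻ p in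
        Equivalence.from (∈-factorizations a b c m)
          (shift⇒factorization basic {k} {n} {x₀ + k * l ∸ n * w} {y₀ + n * h ∸ k * y} {z₀ ∸ k * δ}
            (shift (m∸n+n≡m x≥0) (m∸n+n≡m y≥0)) (m∸n+n≡m z≥0))
      inj : ∀ {p q} → p ∈ filter valid? candidates → q ∈ filter valid? candidates →
            shifted p ≡ shifted q → p ≡ q
      -- The third coordinate determines k because δ > 0; the first then determines n because w > 0.
      inj {k , n} {k′ , n′} p q e = cong₂ _,_ k≡k′
        (*-cancelʳ-≡ n n′ w (∸-cancelˡ-≡ (proj₂ (proj₁ (∈-valid⁻ p)))
          (subst (λ t → n′ * w ≤ x₀ + t * l) (sym k≡k′) (proj₂ (proj₁ (∈-valid⁻ q))))
          (trans (cong proj₁ e) (cong (λ t → x₀ + t * l ∸ n′ * w) (sym k≡k′)))))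
        where
        k≡k′ : k ≡ k′
        k≡k′ = *-cancelʳ-≡ k k′ δ (∸-cancelˡ-≡ (proj₁ (proj₁ (∈-valid⁻ p)))
          (proj₁ (proj₁ (∈-valid⁻ q))) (cong (λ t → proj₂ (proj₂ t)) e))
      unshift : ∀ {u v t} → u + v ≡ t → u ≡ t ∸ v
      unshift {u} {v} refl = sym (m+n∸n≡m u v)
      addend≤ : ∀ {u v t} → u + v ≡ t → v ≤ t
      addend≤ {u} {v} refl = m≤n+m v u
      onto : ∀ {t} → t ∈ factorizations a b c m → ∃[ p ] p ∈ filter valid? candidates × t ≡ shifted p
      onto t∈ =
        let k , n , shift e₁ e₂ , e₃ =
              factorization⇒shift basic (Equivalence.to (∈-factorizations a b c m) t∈) in
        (k , n) ,
        ∈-filter⁺ valid? (∈-candidates⁺ (addend≤ e₃) (addend≤ e₁)) (addend≤ e₂) ,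
        cong₂ _,_ (unshift e₁) (cong₂ _,_ (unshift e₂) (unshift e₃))

    -- The lines y = 0 and x = 0 in the (k , n)-plane meet at negative k.
    invalid⇒x≥0 : ∀ {k n} → y₀ + n * h < k * y → n * w ≤ x₀ + k * l
    invalid⇒x≥0 {k} {n} invalid = ≤-trans (*-cancelʳ-≤ (n * w) (k * l) h (begin
      n * w * h    ≡⟨ swap n w h ⟩
      n * h * w    ≤⟨ *-monoˡ-≤ w (≤-trans (m≤n+m (n * h) y₀) (<⇒≤ invalid)) ⟩
      k * y * w    ≤⟨ *-mono-≤ (*-monoʳ-≤ k (<⇒≤ y<h)) (<⇒≤ w<l) ⟩
      k * h * l    ≡⟨ swap k h l ⟩
      k * l * h    ∎)) (m≤n+m (k * l) x₀)
      where
      open ≤-Reasoning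
      swap : ∀ p q r → p * q * r ≡ p * r * q
      swap p q r = trans (*-assoc p q r) (trans (cong (p *_) (*-comm q r)) (sym (*-assoc p r q)))

    module _ (K : ℕ) (q : ℕ → ℕ)
             (invalid⇒ : ∀ {k n} → k ≤ A → y₀ + n * h < k * y → n < K × q n < k)
             (⇒invalid : ∀ {k n} → n < K → q n < k → y₀ + n * h < k * y) where

      -- For each n < K the invalid k are those with q n < k ≤ A. By `invalid⇒x≥0` they are all
      -- candidates, so nothing else limits them. Keeping `K` and `q` abstract lets y = 0 and y > 0
      -- share the argument.
      denumerant+invalid : denumerant a b c m + ∑ K (λ n → A ∸ q n) ≡
                           ∑ (suc A) (λ k → suc ((x₀ + k * l) / w))
      denumerant+invalid = begin
        denumerant a b c m + ∑ K (λ n → A ∸ q n)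
          ≡⟨ cong₂ _+_ length-valid (length-region K (λ n → A ∸ q n)) ⟨
        length (filter valid? candidates) + length (region K (λ n → A ∸ q n))
          -- The invalid k for a given n are listed downwards from A, as A - i with i < A - q n.
          ≡⟨ length-complement valid? (λ (n , i) → A ∸ i , n)
               candidates-unique (region-unique K _) into inj onto ⟩
        length candidates
          ≡⟨ length-region (suc A) _ ⟩
        ∑ (suc A) (λ k → suc ((x₀ + k * l) / w)) ∎
        where
        open ≡-Reasoning
        i<A∸q⇒q<A∸i : ∀ {i q} → i < A ∸ q → q < A ∸ i
        i<A∸q⇒q<A∸i {i} {q} i< = m+n≤o⇒m≤o∸n (suc q) (subst (_≤ A) (cong suc (+-comm i q))
          (m≤o∸n⇒m+n≤o (suc i) {q} (<⇒≤ (m∸n≢0⇒n<m (m<n⇒n≢0 i<))) i<))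
        into : ∀ {p} → p ∈ region K (λ n → A ∸ q n) →
               (A ∸ proj₂ p , proj₁ p) ∈ candidates × ¬ Valid (A ∸ proj₂ p , proj₁ p)
        into {n , i} p =
          let n<K , i< = ∈-region⁻ K _ p
              invalid  = ⇒invalid n<K (i<A∸q⇒q<A∸i i<)
          in ∈-candidates⁺ (m≤o/n⇒m*n≤o (m∸n≤m A i)) (invalid⇒x≥0 {A ∸ i} {n} invalid) , <⇒≱ invalid
        inj : ∀ {p p′} → p ∈ region K (λ n → A ∸ q n) → p′ ∈ region K (λ n → A ∸ q n) →
              (A ∸ proj₂ p , proj₁ p) ≡ (A ∸ proj₂ p′ , proj₁ p′) → p ≡ p′
        inj {n , i} {n′ , i′} p p′ e = cong₂ _,_ (cong proj₂ e)
          (∸-cancelˡ-≡ (≤A p) (≤A p′) (cong proj₁ e))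
          where
          ≤A : ∀ {n i} → (n , i) ∈ region K (λ n → A ∸ q n) → i ≤ A
          ≤A {n} p = ≤-trans (<⇒≤ (proj₂ (∈-region⁻ K _ p))) (m∸n≤m A (q n))
        onto : ∀ {v} → v ∈ candidates → ¬ Valid v →
               ∃[ p ] p ∈ region K (λ n → A ∸ q n) × v ≡ (A ∸ proj₂ p , proj₁ p)
        onto {k , n} p ¬valid =
          let k≤A = s≤s⁻¹ (proj₁ (∈-region⁻ (suc A) _ p))
              n<K , q<k = invalid⇒ k≤A (≰⇒> ¬valid)
          in (n , A ∸ k) , ∈-region⁺ K _ n<K (∸-monoʳ-< q<k k≤A) , cong (_, n) (sym (m∸[m∸n]≡n k≤A))

-- Sums of floors along arithmetic progressions.

module Sums where
  open import Data.Nat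
  open import Data.Nat.Properties
  open import Data.Nat.DivMod
  open import Data.Nat.Divisibility using (n∣m*n)
  open import Data.Nat.Tactic.RingSolver using (solve)
  open Counting

  ∑-suc : ∀ n f → ∑ n (λ k → suc (f k)) ≡ n + ∑ n f
  ∑-suc zero    f = refl
  ∑-suc (suc n) f = begin
    ∑ n (λ k → suc (f k)) + suc (f n)  ≡⟨ cong (_+ suc (f n)) (∑-suc n f) ⟩
    n + ∑ n f + suc (f n)              ≡⟨ +-suc (n + ∑ n f) (f n) ⟩
    suc (n + ∑ n f + f n)              ≡⟨ cong suc (+-assoc n (∑ n f) (f n)) ⟩
    suc (n + (∑ n f + f n))            ∎
    where open ≡-Reasoning

  ∑-complement : ∀ n s f → (∀ {k} → k < n → f k ≤ s) → ∑ n (λ k → s ∸ f k) + ∑ n f ≡ n * s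
  ∑-complement zero    s f f≤s = refl
  ∑-complement (suc n) s f f≤s = begin
    (∑ n g + g n) + (∑ n f + f n)  ≡⟨ interchange (∑ n g) (g n) (∑ n f) (f n) ⟩
    (g n + f n) + (∑ n g + ∑ n f)  ≡⟨ cong₂ _+_ (m∸n+n≡m (f≤s ≤-refl)) (∑-complement n s f (λ k<n → f≤s (m<n⇒m<1+n k<n))) ⟩
    s + n * s                      ∎
    where
    open ≡-Reasoning
    g = λ k → s ∸ f k
    interchange : ∀ p q r t → (p + q) + (r + t) ≡ (q + t) + (p + r)
    interchange p q r t = solve (p ∷ q ∷ r ∷ t ∷ [])

  ∑-id : ∀ n → ∑ (suc n) id * 2 ≡ n * suc n
  ∑-id zero    = refl
  ∑-id (suc n) = begin
    (∑ (suc n) id + suc n) * 2      ≡⟨ *-distribʳ-+ 2 (∑ (suc n) id) (suc n) ⟩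
    ∑ (suc n) id * 2 + suc n * 2    ≡⟨ cong (_+ suc n * 2) (∑-id n) ⟩
    n * suc n + suc n * 2           ≡⟨ solve (n ∷ []) ⟩
    suc n * suc (suc n)             ∎
    where open ≡-Reasoning

  module _ (u v d : ℕ) .{{_ : NonZero d}} where

    -- After division of u and v by d with remainder, the multiples of d leave the floor.
    quotient-split : ∀ k → (u + k * v) / d ≡ u / d + k * (v / d) + (u % d + k * (v % d)) / d
    quotient-split k = begin
      (u + k * v) / d
        ≡⟨ cong₂ (λ s t → (s + k * t) / d) (m≡m%n+[m/n]*n u d) (m≡m%n+[m/n]*n v d) ⟩
      (u % d + u / d * d + k * (v % d + v / d * d)) / d
        ≡⟨ cong (_/ d) (regroup (u % d) (u / d) (v % d) (v / d)) ⟩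
      ((u / d + k * (v / d)) * d + (u % d + k * (v % d))) / d
        ≡⟨ +-distrib-/-∣ˡ (u % d + k * (v % d)) (n∣m*n (u / d + k * (v / d))) ⟩
      (u / d + k * (v / d)) * d / d + (u % d + k * (v % d)) / d
        ≡⟨ cong (_+ (u % d + k * (v % d)) / d) (m*n/n≡m (u / d + k * (v / d)) d) ⟩
      u / d + k * (v / d) + (u % d + k * (v % d)) / d ∎
      where
      open ≡-Reasoning
      regroup : ∀ r q r′ q′ → r + q * d + k * (r′ + q′ * d) ≡ (q + k * q′) * d + (r + k * r′)
      regroup r q r′ q′ = solve (r ∷ q ∷ r′ ∷ q′ ∷ d ∷ k ∷ [])

    -- Used with (x₀ , l , w) and (y₀ , h , y), this produces the linear terms, the triangular terms
    -- and the remaining floor sums of the final formulas.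
    ∑-quotient : ∀ n → ∑ n (λ k → (u + k * v) / d) ≡
                       n * (u / d) + v / d * ∑ n id + floorSum n (u % d) (v % d) d
    ∑-quotient n = trans (split n)
      (cong (n * (u / d) + v / d * ∑ n id +_) (sym (sum-applyUpTo (λ k → (u % d + k * (v % d)) / d) n)))
      where
      open ≡-Reasoning
      step : ∀ n q q′ t s r → (n * q + q′ * t + s) + (q + n * q′ + r) ≡ suc n * q + q′ * (t + n) + (s + r)
      step n q q′ t s r = solve (n ∷ q ∷ q′ ∷ t ∷ s ∷ r ∷ [])
      split : ∀ n → ∑ n (λ k → (u + k * v) / d) ≡
                    n * (u / d) + v / d * ∑ n id + ∑ n (λ k → (u % d + k * (v % d)) / d)
      split zero    = sym (trans (+-identityʳ _) (*-zeroʳ (v / d)))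
      split (suc n) = begin
        ∑ n (λ k → (u + k * v) / d) + (u + n * v) / d
          ≡⟨ cong₂ _+_ (split n) (quotient-split n) ⟩
        (n * (u / d) + v / d * ∑ n id + ∑ n (λ k → (u % d + k * (v % d)) / d)) +
        (u / d + n * (v / d) + (u % d + n * (v % d)) / d)
          ≡⟨ step n (u / d) (v / d) (∑ n id) _ _ ⟩
        suc n * (u / d) + v / d * (∑ n id + n) + (∑ n (λ k → (u % d + k * (v % d)) / d) + (u % d + n * (v % d)) / d) ∎

  -- On the left, k A comes from the Σ_{n < k} (A - ⌊…⌋) pairs to be removed.
  record Expansion (d A k x̄ ȳ l̄ h̄ S : ℕ) (S′ : ℕ → ℕ) : Set where
    constructor expansion
    field
      count : d + k * A ≡ suc A + (suc A * x̄ + l̄ * ∑ (suc A) id + S) + (k * ȳ + h̄ * ∑ k id + S′ k)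

-- Passage to the integers: the ceiling, triangular numbers and the closed formulas.

module Integers where
  open import Data.Nat as ℕ using (ℕ; zero; suc; NonZero)
  import Data.Nat.Properties as ℕ
  import Data.Nat.DivMod as ℕ
  open import Data.Integer using (+_; -[1+_]; -_; _+_; _-_; _*_; _/ℕ_; _%ℕ_)
  open import Data.Integer.Properties
  open import Data.Integer.DivMod using (div-pos-is-/ℕ; a≡a%ℕn+[a/ℕn]*n; n%ℕd<d)
  open import Data.Integer.Tactic.RingSolver using (solve)
  open import Data.Rational.Unnormalised as ℚᵘ using (ceiling)
  open Counting
  open Sums
  open ≡-Reasoning

  +-products : ∀ p q r s → + p * + q + + r * + s ≡ + (p ℕ.* q ℕ.+ r ℕ.* s)
  +-products p q r s = trans (cong₂ _+_ (sym (pos-* p q)) (sym (pos-* r s))) (sym (pos-+ (p ℕ.* q) (r ℕ.* s)))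

  -- Brings the equations that define δ and θ into subtraction-free form over the natural numbers.
  unsubtract : ∀ p q r s t u → + p * + q - + r * + s ≡ + t * + u → p ℕ.* q ≡ r ℕ.* s ℕ.+ t ℕ.* u
  unsubtract p q r s t u e = +-injective (begin
    + (p ℕ.* q)                          ≡⟨ pos-* p q ⟩
    + p * + q                            ≡⟨ add-back (+ p * + q) (+ r * + s) ⟩
    + r * + s + (+ p * + q - + r * + s)  ≡⟨ cong (λ i → + r * + s + i) e ⟩
    + r * + s + + t * + u                ≡⟨ +-products r s t u ⟩
    + (r ℕ.* s ℕ.+ t ℕ.* u)              ∎)
    where
    add-back : ∀ i j → i ≡ j + (i - j)
    add-back i j = solve (i ∷ j ∷ [])

  -- The ceiling is minus the floor q of - (u - v) / a, and (u - v) / a > - 1 forces q ≤ 0. The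
  -- remainder r turns the ceiling into an equation between natural numbers.
  ceiling-nonneg : ∀ u v a .{{_ : NonZero a}} → v ℕ.< u ℕ.+ a →
                   ∃[ k ] ∃[ r ] ceiling ((+ u - + v) ℚᵘ./ a) ≡ + k × r ℕ.< a × u ℕ.+ r ≡ k ℕ.* a ℕ.+ v
  ceiling-nonneg u v a@(suc a-1) v<u+a =
    go (- (+ u - + v) /ℕ a) (a≡a%ℕn+[a/ℕn]*n (- (+ u - + v)) a)
       (cong -_ (div-pos-is-/ℕ (- (+ u - + v)) a))
    where
    r = - (+ u - + v) %ℕ a
    move⁺ : ∀ u v r s → - (u - v) ≡ r + s → v ≡ u + (r + s)
    move⁺ u v r s e = trans (lemma u v) (cong (λ i → u + i) e)
      where
      lemma : ∀ u v → v ≡ u + - (u - v)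
      lemma u v = solve (u ∷ v ∷ [])
    move⁻ : ∀ u v r s → - (u - v) ≡ r + - s → u + r ≡ s + v
    move⁻ u v r s e = trans (lemma u r s) (trans (cong (λ i → s + (u + i)) (sym e)) (lemma′ u v s))
      where
      lemma : ∀ u r s → u + r ≡ s + (u + (r + - s))
      lemma u r s = solve (u ∷ r ∷ s ∷ [])
      lemma′ : ∀ u v s → s + (u + - (u - v)) ≡ s + v
      lemma′ u v s = solve (u ∷ v ∷ s ∷ [])
    go : ∀ q → - (+ u - + v) ≡ + r + q * + a → ceiling ((+ u - + v) ℚᵘ./ a) ≡ - q →
         ∃[ k ] ∃[ r ] ceiling ((+ u - + v) ℚᵘ./ a) ≡ + k × r ℕ.< a × u ℕ.+ r ≡ k ℕ.* a ℕ.+ v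
    go (+ zero) e c = 0 , r , c , n%ℕd<d (- (+ u - + v)) a ,
      sym (+-injective (trans (move⁺ (+ u) (+ v) (+ r) (+ 0 * + a) e) (cong (λ i → + u + i) (+-identityʳ (+ r)))))
    -- A positive q would give v ≥ u + a.
    go (+ suc q) e c with () ← ℕ.<⇒≱ v<u+a (subst (u ℕ.+ a ℕ.≤_)
      (sym (+-injective (trans (move⁺ (+ u) (+ v) (+ r) (+ suc q * + a) e)
        (cong (λ i → + u + (+ r + i)) (sym (pos-* (suc q) a))))))
      (ℕ.+-monoʳ-≤ u (ℕ.≤-trans (ℕ.m≤m+n a (q ℕ.* a)) (ℕ.m≤n+m _ r))))
    go -[1+ q ] e c = suc q , r , c , n%ℕd<d (- (+ u - + v)) a ,
      +-injective (trans (move⁻ (+ u) (+ v) (+ r) (+ suc q * + a)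
        (trans e (cong (λ i → + r + i) (sym (neg-distribˡ-* (+ suc q) (+ a)))))) (cong (_+ + v) (sym (pos-* (suc q) a))))

  triangular : ∀ n → + n * (+ 1 + + n) /ℕ 2 ≡ + ∑ (suc n) id
  triangular n = begin
    + n * (+ 1 + + n) /ℕ 2      ≡⟨ cong (_/ℕ 2) (pos-* n (suc n)) ⟨
    + (n ℕ.* suc n ℕ./ 2)       ≡⟨ cong (λ t → + (t ℕ./ 2)) (∑-id n) ⟨
    + (∑ (suc n) id ℕ.* 2 ℕ./ 2) ≡⟨ cong +_ (ℕ.m*n/n≡m (∑ (suc n) id) 2) ⟩
    + ∑ (suc n) id              ∎

  triangular-pred : ∀ k → (+ k - + 1) * + k /ℕ 2 ≡ + ∑ k id
  -- For k = 0 the integer product (- 1) 0 vanishes, in agreement with the empty sum.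
  triangular-pred zero    = refl
  triangular-pred (suc n) = triangular n

  2∑-id : ∀ n → + ∑ (suc n) id * + 2 ≡ + n * (+ 1 + + n)
  2∑-id n = trans (sym (pos-* (∑ (suc n) id) 2)) (trans (cong +_ (∑-id n)) (pos-* n (suc n)))

  module _ {d A k x̄ ȳ l̄ h̄ S S′} (exp : Expansion d A k x̄ ȳ l̄ h̄ S S′) where

    open Expansion exp

    -- With T = A (1 + A) / 2, the product (1 + A)(1 + A + x̄) exceeds (1 + A)(1 + x̄) by A (1 + A)
    -- = 2 T, which the - 2 in l̄ - 2 takes back. The term k A of `count` moves over to form k (ȳ -
    -- A).
    count-ℤ : + d ≡ (+ 1 + + A) * (+ 1 + + A + + x̄) + + k * (+ ȳ - + A)
                    + (+ l̄ - + 2) * (+ A * (+ 1 + + A) /ℕ 2) + + h̄ * ((+ k - + 1) * + k /ℕ 2) + + S + + S′ k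
    count-ℤ = begin
      + d
        ≡⟨ lemma₁ (+ d) (+ k) (+ A) ⟩
      (+ d + + k * + A) - + k * + A
        ≡⟨ cong (_- + k * + A) (trans (trans (cong (λ i → + d + i) (sym (pos-* k A))) (cong +_ count)) push) ⟩
      RHS - + k * + A
        -- The ring identity treats T as a free variable, so 2 T - A (1 + A) stays as a separate
        -- summand until `2∑-id` removes it.
        ≡⟨ lemma₂ (+ A) (+ x̄) (+ ȳ) (+ k) (+ l̄) (+ h̄) (+ ∑ (suc A) id) (+ ∑ k id) (+ S) (+ S′ k) ⟩
      E (+ ∑ (suc A) id) (+ ∑ k id) + (+ ∑ (suc A) id * + 2 - + A * (+ 1 + + A))
        ≡⟨ cong (λ i → E (+ ∑ (suc A) id) (+ ∑ k id) + (i - + A * (+ 1 + + A))) (2∑-id A) ⟩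
      E (+ ∑ (suc A) id) (+ ∑ k id) + (+ A * (+ 1 + + A) - + A * (+ 1 + + A))
        ≡⟨ cong (λ i → E (+ ∑ (suc A) id) (+ ∑ k id) + i) (+-inverseʳ (+ A * (+ 1 + + A))) ⟩
      E (+ ∑ (suc A) id) (+ ∑ k id) + + 0
        ≡⟨ +-identityʳ _ ⟩
      E (+ ∑ (suc A) id) (+ ∑ k id)
        ≡⟨ cong₂ E (triangular A) (triangular-pred k) ⟨
      E (+ A * (+ 1 + + A) /ℕ 2) ((+ k - + 1) * + k /ℕ 2) ∎
      where
      E = λ T T′ → (+ 1 + + A) * (+ 1 + + A + + x̄) + + k * (+ ȳ - + A) + (+ l̄ - + 2) * T + + h̄ * T′ + + S + + S′ k
      RHS = (+ 1 + + A) + ((+ 1 + + A) * + x̄ + + l̄ * + ∑ (suc A) id + + S) + (+ k * + ȳ + + h̄ * + ∑ k id + + S′ k)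
      push = cong₂ _+_ (cong (λ i → + suc A + (i + + S)) (sym (+-products (suc A) x̄ l̄ (∑ (suc A) id))))
                       (cong (_+ + S′ k) (sym (+-products k ȳ h̄ (∑ k id))))
      lemma₁ : ∀ d k A → d ≡ (d + k * A) - k * A
      lemma₁ d k A = solve (d ∷ k ∷ A ∷ [])
      lemma₂ : ∀ A x̄ ȳ k l̄ h̄ T T′ S S′ →
        (+ 1 + A) + ((+ 1 + A) * x̄ + l̄ * T + S) + (k * ȳ + h̄ * T′ + S′) - k * A ≡
        (+ 1 + A) * (+ 1 + A + x̄) + k * (ȳ - A) + (l̄ - + 2) * T + h̄ * T′ + S + S′ + (T * + 2 - A * (+ 1 + A))
      lemma₂ A x̄ ȳ k l̄ h̄ T T′ S S′ = solve (A ∷ x̄ ∷ ȳ ∷ k ∷ l̄ ∷ h̄ ∷ T ∷ T′ ∷ S ∷ S′ ∷ [])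

    -- Every term with ȳ or h̄ carries a factor that vanishes at k = 0. This serves both y = 0 and
    -- k₁ = 0.
    count-zero : k ≡ 0 → S′ 0 ≡ 0 → + d ≡ (+ 1 + + A) * (+ 1 + + A + + x̄) + (+ l̄ - + 2) * (+ A * (+ 1 + + A) /ℕ 2) + + S
    count-zero refl S′0≡0 = trans count-ℤ (trans
      (lemma (+ A) (+ x̄) (+ ȳ) (+ l̄) (+ h̄) (+ A * (+ 1 + + A) /ℕ 2) (+ S) (+ S′ 0))
      (trans (cong (λ s → F + + s) S′0≡0) (+-identityʳ F)))
      where
      F = (+ 1 + + A) * (+ 1 + + A + + x̄) + (+ l̄ - + 2) * (+ A * (+ 1 + + A) /ℕ 2) + + S
      lemma : ∀ A x̄ ȳ l̄ h̄ T S S′ →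
        (+ 1 + A) * (+ 1 + A + x̄) + + 0 * (ȳ - A) + (l̄ - + 2) * T + h̄ * + 0 + S + S′ ≡
        (+ 1 + A) * (+ 1 + A + x̄) + (l̄ - + 2) * T + S + S′
      lemma A x̄ ȳ l̄ h̄ T S S′ = solve (A ∷ x̄ ∷ ȳ ∷ l̄ ∷ h̄ ∷ T ∷ S ∷ S′ ∷ [])

    -- At k = 1 + A the - A in k (ȳ - A) cancels against (1 + A) A, and both triangular numbers
    -- become A (1 + A) / 2, so l̄ and h̄ combine.
    count-full : k ≡ suc A → + d ≡ (+ 1 + + A) * (+ 1 + + x̄ + + ȳ) + (+ l̄ + + h̄ - + 2) * (+ A * (+ 1 + + A) /ℕ 2) + + S + + S′ (suc A)
    count-full refl = trans count-ℤ (lemma (+ A) (+ x̄) (+ ȳ) (+ l̄) (+ h̄) (+ A * (+ 1 + + A) /ℕ 2) (+ S) (+ S′ (suc A)))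
      where
      lemma : ∀ A x̄ ȳ l̄ h̄ T S S′ → (+ 1 + A) * (+ 1 + A + x̄) + (+ 1 + A) * (ȳ - A) + (l̄ - + 2) * T + h̄ * T + S + S′ ≡
                               (+ 1 + A) * (+ 1 + x̄ + ȳ) + (l̄ + h̄ - + 2) * T + S + S′
      lemma A x̄ ȳ l̄ h̄ T S S′ = solve (A ∷ x̄ ∷ ȳ ∷ l̄ ∷ h̄ ∷ T ∷ S ∷ S′ ∷ [])

-- The invalid pairs in terms of k₁.

module Formula where
  open import Data.Nat
  open import Data.Nat.Properties
  open import Data.Nat.DivMod
  open Counting
  open Sums
  open Shifts

  module Count (H : LShape) (a b c δ : ℕ) .{{_ : NonZero a}} .{{_ : NonZero b}} .{{_ : NonZero c}}
               (rel : Related H a b c)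
               (la≡yb+δc : LShape.l H * a ≡ LShape.y H * b + δ * c)
               (hb≡wa : LShape.h H * b ≡ LShape.w H * a)
               (m x₀ y₀ z₀ : ℕ) (basic : IsBasicFactorization H a b c m (x₀ , y₀ , z₀)) where

    open LShape H
    open Denumerant H a b c δ rel la≡yb+δc hb≡wa m x₀ y₀ z₀ basic public

    -- With y = 0 no pair can violate k y ≤ y₀ + n h, so K = 0; the zeros in the places of ȳ and h̄
    -- are placeholders.
    count-y≡0 : y ≡ 0 → Expansion (denumerant a b c m) A 0 (x₀ / w) 0 (l / w) 0
                                  (floorSum (suc A) (x₀ % w) (l % w) w) (λ _ → 0)
    count-y≡0 y≡0 = expansion (begin
      denumerant a b c m + 0
        ≡⟨ denumerant+invalid 0 id (λ {k} _ inv → not-below k inv) (λ ()) ⟩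
      ∑ (suc A) (λ k → suc ((x₀ + k * l) / w))
        ≡⟨ trans (∑-suc (suc A) _) (cong (suc A +_) (∑-quotient x₀ l w (suc A))) ⟩
      _ ≡⟨ +-identityʳ _ ⟨
      _ ∎)
      where
      open ≡-Reasoning
      not-below : ∀ k {s} {X : Set} → s < k * y → X
      not-below k s<ky with () ← <⇒≱ s<ky (≤-trans (≤-reflexive (trans (cong (k *_) y≡0) (*-zeroʳ k))) z≤n)

    -- Since y₀ < h and a = h δ, already y₀ δ < a; this is why k₁ ≥ 0.
    ceiling-bound : y₀ * δ < z₀ * y + a
    ceiling-bound = <-≤-trans (*-monoˡ-< δ (proj₁ (proj₂ (proj₂ basic))))
      (≤-trans (≤-reflexive (sym a≡hδ)) (m≤n+m a (z₀ * y)))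

    module _ .{{_ : NonZero y}} {K r : ℕ} (r<a : r < a) (z₀y+r≡Ka+y₀δ : z₀ * y + r ≡ K * a + y₀ * δ) where

      scale : ∀ n → (y₀ + n * h) * δ ≡ n * a + y₀ * δ
      scale n = begin
        (y₀ + n * h) * δ        ≡⟨ *-distribʳ-+ δ y₀ (n * h) ⟩
        y₀ * δ + n * h * δ      ≡⟨ cong (y₀ * δ +_) (*-assoc n h δ) ⟩
        y₀ * δ + n * (h * δ)    ≡⟨ cong (λ t → y₀ * δ + n * t) a≡hδ ⟨
        y₀ * δ + n * a          ≡⟨ +-comm (y₀ * δ) (n * a) ⟩
        n * a + y₀ * δ          ∎
        where open ≡-Reasoning

      -- The hypotheses on r say that K is the ceiling of (z₀ y - y₀ δ) / a, and by `scale` each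
      -- unit of n contributes exactly a. With the converse `<K⇒`, n < K holds exactly when some
      -- real k ≤ z₀ / δ violates k y ≤ y₀ + n h.
      ⇒<K : ∀ {n} → (y₀ + n * h) * δ < z₀ * y → n < K
      ⇒<K {n} lt = ≰⇒> λ K≤n → <⇒≱ lt (begin
        z₀ * y             ≤⟨ m≤m+n (z₀ * y) r ⟩
        z₀ * y + r         ≡⟨ z₀y+r≡Ka+y₀δ ⟩
        K * a + y₀ * δ     ≤⟨ +-monoˡ-≤ (y₀ * δ) (*-monoˡ-≤ a K≤n) ⟩
        n * a + y₀ * δ     ≡⟨ scale n ⟨
        (y₀ + n * h) * δ   ∎)
        where open ≤-Reasoning

      <K⇒ : ∀ {n} → n < K → (y₀ + n * h) * δ < z₀ * y
      <K⇒ {n} n<K = +-cancelˡ-< a _ _ (begin-strict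
        a + (y₀ + n * h) * δ      ≡⟨ cong (a +_) (scale n) ⟩
        a + (n * a + y₀ * δ)      ≡⟨ +-assoc a (n * a) (y₀ * δ) ⟨
        suc n * a + y₀ * δ        ≤⟨ +-monoˡ-≤ (y₀ * δ) (*-monoˡ-≤ a n<K) ⟩
        K * a + y₀ * δ            ≡⟨ z₀y+r≡Ka+y₀δ ⟨
        z₀ * y + r                <⟨ +-monoʳ-< (z₀ * y) r<a ⟩
        z₀ * y + a                ≡⟨ +-comm (z₀ * y) a ⟩
        a + z₀ * y                ∎)
        where open ≤-Reasoning

      q : ℕ → ℕ
      q n = (y₀ + n * h) / y

      -- For n < K the real quotient (y₀ + n h) / y is below z₀ / δ, so the same holds weakly for
      -- the floors. Equality is possible: that n then has no invalid k.
      q≤A : ∀ {n} → n < K → q n ≤ A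
      q≤A {n} n<K = ≮⇒≥ λ A<q → <⇒≱ (<K⇒ n<K) (begin
        z₀ * y             ≤⟨ *-monoˡ-≤ y (<⇒≤ (≰⇒> {suc A * δ} {z₀} λ δ≤ → <-irrefl refl (m*n≤o⇒m≤o/n {suc A} {δ} δ≤))) ⟩
        suc A * δ * y      ≡⟨ *-assoc (suc A) δ y ⟩
        suc A * (δ * y)    ≡⟨ cong (suc A *_) (*-comm δ y) ⟩
        suc A * (y * δ)    ≡⟨ *-assoc (suc A) y δ ⟨
        suc A * y * δ      ≤⟨ *-monoˡ-≤ δ (m≤o/n⇒m*n≤o A<q) ⟩
        (y₀ + n * h) * δ   ∎)
        where open ≤-Reasoning

      -- Because y < h, q n ≥ n; so n = 1 + A < K would contradict `q≤A`.
      K≤1+A : K ≤ suc A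
      K≤1+A = ≮⇒≥ λ 1+A<K → <⇒≱ (s≤s (q≤A 1+A<K)) (m*n≤o⇒m≤o/n
        (≤-trans (*-monoʳ-≤ (suc A) (<⇒≤ y<h)) (m≤n+m (suc A * h) y₀)))

      -- By `q≤A` the differences A - q n are exact, so their sum is K A minus the sum of the floors
      -- q n. Both floor sums are then expanded.
      count-y>0 : Expansion (denumerant a b c m) A K (x₀ / w) (y₀ / y) (l / w) (h / y)
                            (floorSum (suc A) (x₀ % w) (l % w) w) (λ n → floorSum n (y₀ % y) (h % y) y)
      count-y>0 = expansion (begin
        denumerant a b c m + K * A
          ≡⟨ cong (denumerant a b c m +_) (∑-complement K A q q≤A) ⟨
        denumerant a b c m + (∑ K (λ n → A ∸ q n) + ∑ K q)
          ≡⟨ +-assoc (denumerant a b c m) _ _ ⟨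
        denumerant a b c m + ∑ K (λ n → A ∸ q n) + ∑ K q
          ≡⟨ cong (_+ ∑ K q) (denumerant+invalid K q invalid⇒ (λ _ q<k → ≰⇒> λ ky≤ → <⇒≱ q<k (m*n≤o⇒m≤o/n ky≤))) ⟩
        ∑ (suc A) (λ k → suc ((x₀ + k * l) / w)) + ∑ K q
          ≡⟨ cong₂ _+_ (trans (∑-suc (suc A) _) (cong (suc A +_) (∑-quotient x₀ l w (suc A)))) (∑-quotient y₀ h y K) ⟩
        _ ∎)
        where
        open ≡-Reasoning
        invalid⇒ : ∀ {k n} → k ≤ A → y₀ + n * h < k * y → n < K × q n < k
        -- Multiply y₀ + n h < k y by δ and use k δ ≤ z₀.
        invalid⇒ {k} {n} k≤A inv = ⇒<K bound , m<n*o⇒m/o<n inv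
          where
          bound : (y₀ + n * h) * δ < z₀ * y
          bound = <-≤-trans (*-monoˡ-< δ inv) (≤-trans (≤-reflexive
            (trans (*-assoc k y δ) (trans (cong (k *_) (*-comm y δ)) (sym (*-assoc k δ y)))))
            (*-monoˡ-≤ y (m≤o/n⇒m*n≤o k≤A)))

-- Assembly of the cases.

open import Data.Nat as ℕ using (ℕ; suc; NonZero; _<_; _≤_; _>_)
open import Data.Nat.DivMod as ℕ using (_%_)
open import Data.Nat.GCD using (gcd)
open import Data.Integer using (+_; 0ℤ; _+_; _-_; _*_; _/ℕ_)
open import Data.Rational.Unnormalised using (ceiling; _/_)
open import Data.Product using (Σ; _×_; _,_; Σ-syntax; ∃-syntax)
import Data.Integer.Properties as ℤ
import Data.Nat.Properties as ℕ
open Formula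
open Integers

theorem6 :
  (a b c : ℕ) .{{_ : NonZero a}} .{{_ : NonZero b}} .{{_ : NonZero c}} →
  a < b → b < c → gcd a (gcd b c) ≡ 1 →
  (H : LShape) → Related H a b c → let open LShape H in
  (δ θ : ℕ) → + l * + a - + y * + b ≡ + δ * + c → + h * + b - + w * + a ≡ + θ * + c →
  (m : ℕ) → m ∈⟨ a , b , c ⟩ →
  (x₀ y₀ z₀ : ℕ) → IsBasicFactorization H a b c m (x₀ , y₀ , z₀) →
  θ ≡ 0 →
  Σ[ w≢0 ∈ NonZero w ] Σ[ δ≢0 ∈ NonZero δ ]
  let instance
        _ = w≢0
        _ = δ≢0
      Aₘ = z₀ ℕ./ δ
      A = + Aₘ
      x̄₀ = + (x₀ ℕ./ w)
      l̄ = + (l ℕ./ w)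
      d = + denumerant a b c m
      S = + floorSum (suc Aₘ) (x₀ % w) (l % w) w
      formula** = (+ 1 + A) * (+ 1 + A + x̄₀) + (l̄ - + 2) * (A * (+ 1 + A) /ℕ 2) + S
  in
  (y ≡ 0 → d ≡ formula**) ×
  (.{{_ : NonZero y}} →
    ∃[ k₁ ] ceiling ((+ z₀ * + y - + y₀ * + δ) / a) ≡ + k₁ ×
    let ȳ₀ = + (y₀ ℕ./ y)
        h̄ = + (h ℕ./ y)
        k = + k₁
        S′ = λ n → + floorSum n (y₀ % y) (h % y) y
    in
    (k₁ ≡ 0 → d ≡ formula**) ×
    (1 ≤ k₁ → k₁ ≤ Aₘ →
      d ≡ (+ 1 + A) * (+ 1 + A + x̄₀) + k * (ȳ₀ - A) + (l̄ - + 2) * (A * (+ 1 + A) /ℕ 2)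
          + h̄ * ((k - + 1) * k /ℕ 2) + S + S′ k₁) ×
    (k₁ > Aₘ →
      d ≡ (+ 1 + A) * (+ 1 + x̄₀ + ȳ₀) + (l̄ + h̄ - + 2) * (A * (+ 1 + A) /ℕ 2)
          + S + S′ (suc Aₘ)))
theorem6 a b c _ _ _ H rel δ _ la hb m _ x₀ y₀ z₀ basic refl =
  w≢0 , δ≢0 ,
  (λ y≡0 → count-zero (count-y≡0 y≡0) refl refl) ,
  (λ {{_}} → positive-y)
  where
  open LShape H
  hb≡wa = trans (unsubtract h b w a 0 c hb) (ℕ.+-identityʳ _)
  open Count H a b c δ rel (unsubtract l a y b δ c la) hb≡wa m x₀ y₀ z₀ basic
  positive-y : .{{_ : NonZero y}} → _
  positive-y with K , r , eq , r<a , e ← ceiling-nonneg (z₀ ℕ.* y) (y₀ ℕ.* δ) a ceiling-bound =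
    K ,
    trans (cong₂ (λ s t → ceiling ((s - t) / a)) (sym (ℤ.pos-* z₀ y)) (sym (ℤ.pos-* y₀ δ))) eq ,
    (λ K≡0 → count-zero (count-y>0 {K} r<a e) K≡0 refl) ,
    (λ _ _ → count-ℤ (count-y>0 {K} r<a e)) ,
    -- K > A together with K ≤ 1 + A leaves only K = 1 + A.
    (λ K>A → count-full (count-y>0 {K} r<a e) (ℕ.≤-antisym (K≤1+A {K} r<a e) K>A))
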